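{- Any (probabilistic bounded error or deterministic) symbolic algorithm that solves Reachability in directed graphs with diameter $D$ requires $\Omega(D)$ symbolic one-step operations.
   Context: Symbolic model: the input is a finite directed graph $G=(V,E)$ (self-loops allowed), $n=|V|$, together with a starting vertex $s\in V$ and a target set $T\subseteq V$. The algorithm knows $V$, $s$, $T$, but it can access $E$ only through the one-step operations $\mathrm{Pre}(S)=\{v\in V\mid \exists s'\in S:(v,s')\in E\}$ and $\mathrm{Post}(S)=\{v\in V\mid \exists s'\in S:(s',v)\in E\}$ applied to (adaptively chosen) sets $S\subseteq V$. All other computation, in particular basic set operations on vertex sets, is unrestricted and not counted in lower bounds; any number of sets may be stored. A probabilistic bounded error algorithm may use random bits and must be correct with probability at least $2/3$ on every input. Reachability: decide whether there is an infinite path in $G$ starting from $s$ that visits a vertex of $T$ at least once. Convention for lower bounds: "requires $\Omega(D)$ one-step operations" means: there is an absolute constant $c>0$ such that every (deterministic or probabilistic bounded error) symbolic algorithm solving the problem on all inputs performs, on inputs with arbitrarily large $D$, at least $c\cdot D$ one-step operations (worst case over its random choices). The diameter $D$ of $G$ is the largest finite distance: the maximum of $d(u,v)$ over all pairs $u,v$ such that $u$ can reach $v$, where $d(u,v)$ is the smallest number of edges on a path from $u$ to $v$. -}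

module Defs where

open import Data.Bool using (Bool; true; false; if_then_else_; _≟_)
open import Data.Fin using (Fin)
open import Data.Fin.Properties using (any?)
open import Data.Fin.Subset using (Subset; _∈_)
open import Data.Fin.Subset.Properties using (_∈?_)
open import Data.Integer using (+_)
open import Data.List using (List; []; _∷_)
open import Data.Nat using (ℕ; zero; suc; _≤_)
open import Data.Product using (Σ-syntax; ∃-syntax; _×_)
open import Data.Rational using (ℚ; 0ℚ; 1ℚ; ½; _/_) renaming (_+_ to _+ℚ_; _*_ to _*ℚ_; _≤_ to _≤ℚ_; _<_ to _<ℚ_)
open import Data.Vec using (tabulate)
open import Level using (0ℓ)
open import Relation.Binary using (Rel; Decidable)
open import Relation.Binary.PropositionalEquality using (_≡_; _≢_)
open import Relation.Nullary using (¬_; does; _×-dec_)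

record Digraph (n : ℕ) : Set₁ where
  field
    Edge  : Rel (Fin n) 0ℓ
    edge? : Decidable Edge

module _ {n : ℕ} (G : Digraph n) where
  open Digraph G

  Pre : Subset n → Subset n
  Pre S = tabulate λ v → does (any? λ s′ → (s′ ∈? S) ×-dec edge? v s′)

  Post : Subset n → Subset n
  Post S = tabulate λ v → does (any? λ s′ → (s′ ∈? S) ×-dec edge? s′ v)

  Reachability : Fin n → Subset n → Set
  Reachability s T =
    Σ[ p ∈ (ℕ → Fin n) ] p 0 ≡ s × (∀ i → Edge (p i) (p (suc i))) × ∃[ i ] p i ∈ T

  data Path : ℕ → Fin n → Fin n → Set where
    []  : ∀ {u} → Path 0 u u
    _∷_ : ∀ {l u v w} → Edge u v → Path l v w → Path (suc l) u w

  IsDistance : Fin n → Fin n → ℕ → Set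
  IsDistance u v d = Path d u v × (∀ l → Path l u v → d ≤ l)

  IsDiameter : ℕ → Set
  IsDiameter D = (∃[ u ] ∃[ v ] IsDistance u v D)
               × (∀ u v d → IsDistance u v d → d ≤ D)

data Event (n : ℕ) : Set where
  bit    : Bool → Event n
  answer : Subset n → Event n

-- Everything learned so far, most recent event first.
History : ℕ → Set
History n = List (Event n)

data Action (n : ℕ) : Set where
  halt     : Bool → Action n
  flip     : Action n
  pre post : Subset n → Action n

-- The next action is an arbitrary function of the history, so all computation
-- between one-step operations is free and every earlier set remains available.
-- The edges of the graph are not an argument.  A run need not halt.
Program : ℕ → Set
Program n = History n → Action n

Algorithm : Set
Algorithm = (n : ℕ) (s : Fin n) (T : Subset n) → Program n

operations : ∀ {n} → History n → ℕ
operations []             = 0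
operations (bit _ ∷ h)    = operations h
operations (answer _ ∷ h) = suc (operations h)

module _ {n : ℕ} (G : Digraph n) (P : Program n) where

  -- The histories that arise on G for some outcome of the random bits.
  data Run : History n → Set where
    start    : Run []
    flipStep : ∀ {h} → Run h → P h ≡ flip → ∀ b → Run (bit b ∷ h)
    preStep  : ∀ {h S} → Run h → P h ≡ pre S → Run (answer (Pre G S) ∷ h)
    postStep : ∀ {h S} → Run h → P h ≡ post S → Run (answer (Post G S) ∷ h)

  -- The probability that, continuing from the given history with fair
  -- independent bits, P halts with output b after at most k further steps.
  haltProb : Bool → ℕ → History n → ℚ
  haltProb b k h with P h
  haltProb b k       h | halt b′ = if does (b ≟ b′) then 1ℚ else 0ℚ
  haltProb b zero    h | flip    = 0ℚ
  haltProb b zero    h | pre _   = 0ℚ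
  haltProb b zero    h | post _  = 0ℚ
  haltProb b (suc k) h | flip    =
    ½ *ℚ (haltProb b k (bit false ∷ h) +ℚ haltProb b k (bit true ∷ h))
  haltProb b (suc k) h | pre S   = haltProb b k (answer (Pre G S) ∷ h)
  haltProb b (suc k) h | post S  = haltProb b k (answer (Post G S) ∷ h)

  -- The probability of output b is the supremum over k of haltProb b k [];
  -- it is at least p iff every rational q < p is attained by some finite k.
  OutputsWithProbAtLeast : ℚ → Bool → Set
  OutputsWithProbAtLeast p b = ∀ q → q <ℚ p → ∃[ k ] q ≤ℚ haltProb b k []

  Outputs : Bool → Set
  Outputs b = ∃[ h ] Run h × P h ≡ halt b

Deterministic : Algorithm → Set
Deterministic A = ∀ n s T h → A n s T h ≢ flip

SolvesReachability : Algorithm → Set₁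
SolvesReachability A = ∀ n (G : Digraph n) s T →
    (Reachability G s T → Outputs G (A n s T) true)
  × (¬ Reachability G s T → Outputs G (A n s T) false)

SolvesReachabilityWithBoundedError : Algorithm → Set₁
SolvesReachabilityWithBoundedError A = ∀ n (G : Digraph n) s T →
    (Reachability G s T → OutputsWithProbAtLeast G (A n s T) (+ 2 / 3) true)
  × (¬ Reachability G s T → OutputsWithProbAtLeast G (A n s T) (+ 2 / 3) false)

{-# OPTIONS --safe #-}

-- Let G have the vertices 0, …, D and the edges u → v with v ≤ u + 1, and let H j be G
-- without the edge j → j + 1; D is reachable from 0 in G but in no H j.  Post S on G
-- depends only on max S, and Pre S only on min S, so each operation has the same answer
-- on G and on H j for all but at most one j.  Summing Pr_G[true] + Pr_{H j}[false] - 1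
-- over j, every operation accounts for at most 1, so that some run on G performs at least
-- as many operations as the sum.  Bounded error makes each of the D summands at least
-- 3/5 + 3/5 - 1 = 1/5, where 3/5 is any rational between 1/2 and 2/3.
module Submission where

open import Defs
open import Data.Integer using (+_)
open import Data.Nat using (ℕ; _≤_)
open import Data.Product using (∃-syntax; _×_)
open import Data.Rational using (ℚ; 0ℚ; _/_) renaming (_*_ to _*ℚ_; _≤_ to _≤ℚ_; _<_ to _<ℚ_)
open import Data.Sum using (_⊎_)

open import Algebra.Bundles using (CommutativeRing)
open import Data.Bool using (Bool; true; false)
open import Data.Fin as Fin using (Fin; zero; suc; toℕ; fromℕ; inject₁)
import Data.Fin.Properties as Fin
open import Data.Fin.Subset using (Subset; _∈_; ⁅_⁆)
open import Data.Fin.Subset.Properties using (_∈?_; x∈⁅x⁆; x∈⁅y⁆⇒x≡y)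
import Data.Integer as ℤ
import Data.Integer.Properties as ℤ
open import Data.List using ([]; _∷_; length)
open import Data.Nat as ℕ using (zero; suc; z≤n; s≤s; _⊔_; _⊓_)
import Data.Nat.Coprimality as Coprimality
import Data.Nat.Properties as ℕ
open import Data.Product using (_,_; proj₁; proj₂)
open import Data.Rational as ℚ using (1ℚ; ½) renaming (_+_ to _+ℚ_; _-_ to _-ℚ_; -_ to -ℚ_)
import Data.Rational.Properties as ℚ
open import Data.Rational.Solver using (module +-*-Solver)
open import Data.Sum using (inj₁; inj₂; [_,_]′)
open import Data.Vec.Properties using (tabulate-cong)
open import Function using (_∘_; _$_; id)
open import Function.Bundles using (_⇔_; mk⇔)
open import Relation.Binary.Definitions using (tri<; tri≈; tri>)
open import Relation.Binary.PropositionalEquality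
open import Relation.Nullary using (¬_; Dec; yes; no; contradiction; ¬?; _×-dec_)
open import Relation.Nullary.Decidable using (does-⇔; toWitness)

open import Algebra.Properties.Semiring.Sum (CommutativeRing.semiring ℚ.+-*-commutativeRing)
  using (sum; *-distribˡ-sum; ∑-distrib-+; sum-cong-≗)
open +-*-Solver using (solve; _:=_; _:+_; _:*_; _:-_; con)

-- Rational arithmetic

suc/1 : ∀ m → + suc m / 1 ≡ 1ℚ +ℚ + m / 1
-- `_/_` divides by a gcd, which is stuck for a variable `m`. With `m / 1` in coprime form, the
-- right side computes to `(1 + m * 1) / 1`.
suc/1 m rewrite ℚ.normalize-coprime {m} {0} (Coprimality.sym (Coprimality.1-coprimeTo m)) =
  cong (λ z → (+ 1 ℤ.+ z) / 1) (sym (ℤ.*-identityʳ (+ m)))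

0≤1 : 0ℚ ≤ℚ 1ℚ
0≤1 = toWitness {a? = 0ℚ ℚ.≤? 1ℚ} _

mean-mono-≤ : ∀ {p q r s} → p ≤ℚ q → r ≤ℚ s → ½ *ℚ (p +ℚ r) ≤ℚ ½ *ℚ (q +ℚ s)
mean-mono-≤ p≤q r≤s = ℚ.*-monoˡ-≤-nonNeg ½ (ℚ.+-mono-≤ p≤q r≤s)

mean-≤ : ∀ {p q r} → p ≤ℚ r → q ≤ℚ r → ½ *ℚ (p +ℚ q) ≤ℚ r
mean-≤ {r = r} p≤r q≤r = ℚ.≤-trans (mean-mono-≤ p≤r q≤r) $
  ℚ.≤-reflexive (solve 1 (λ r → con ½ :* (r :+ r) := r) refl r)

sum-mono-≤ : ∀ {N} {f g : Fin N → ℚ} → (∀ j → f j ≤ℚ g j) → sum f ≤ℚ sum g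
sum-mono-≤ {zero}  f≤g = ℚ.≤-refl
sum-mono-≤ {suc N} f≤g = ℚ.+-mono-≤ (f≤g zero) (sum-mono-≤ (f≤g ∘ suc))

sum-const : ∀ N x → sum {N} (λ _ → x) ≡ x *ℚ (+ N / 1)
sum-const zero    x = sym (ℚ.*-zeroʳ x)
sum-const (suc N) x = begin
  x +ℚ sum {N} (λ _ → x)   ≡⟨ cong (x +ℚ_) (sum-const N x) ⟩
  x +ℚ x *ℚ (+ N / 1)      ≡⟨ solve 2 (λ x n → x :+ x :* n := x :* (con 1ℚ :+ n)) refl x (+ N / 1) ⟩
  x *ℚ (1ℚ +ℚ + N / 1)     ≡⟨ cong (x *ℚ_) (suc/1 N) ⟨
  x *ℚ (+ suc N / 1)       ∎
  where
  open ≡-Reasoning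

sum-mean : ∀ {N} (f g : Fin N → ℚ) →
           sum (λ j → ½ *ℚ (f j +ℚ g j)) ≡ ½ *ℚ (sum f +ℚ sum g)
sum-mean f g = trans (sym (*-distribˡ-sum ½ (λ j → f j +ℚ g j)))
                     (cong (½ *ℚ_) (∑-distrib-+ f g))

-- The exceptional index is a natural number, so that it can be given even when `N` is 0 or when no
-- index is exceptional.
sum-mono-≤-except : ∀ {N} {f g : Fin N → ℚ} m →
  (∀ j → f j ≤ℚ 1ℚ +ℚ g j) → (∀ j → toℕ j ≢ m → f j ≤ℚ g j) → sum f ≤ℚ 1ℚ +ℚ sum g
sum-mono-≤-except {zero}  m f≤1+g f≤g = 0≤1
sum-mono-≤-except {suc N} {f} {g} zero f≤1+g f≤g = ℚ.≤-trans
  (ℚ.+-mono-≤ (f≤1+g zero) (sum-mono-≤ λ j → f≤g (suc j) λ ()))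
  (ℚ.≤-reflexive (ℚ.+-assoc 1ℚ (g zero) (sum (g ∘ suc))))
sum-mono-≤-except {suc N} {f} {g} (suc m) f≤1+g f≤g = ℚ.≤-trans
  (ℚ.+-mono-≤ (f≤g zero λ ())
              (sum-mono-≤-except m (f≤1+g ∘ suc) λ j j≢m → f≤g (suc j) (j≢m ∘ ℕ.suc-injective)))
  (ℚ.≤-reflexive (solve 2 (λ x y → x :+ (con 1ℚ :+ y) := con 1ℚ :+ (x :+ y)) refl
                          (g zero) (sum (g ∘ suc))))

upper-bound : ∀ {N} (f : Fin N → ℕ) → ∃[ K ] ∀ j → f j ≤ K
upper-bound {zero}  f = 0 , λ ()
upper-bound {suc N} f with K , f≤K ← upper-bound (f ∘ suc) = f zero ⊔ K , λ where
  zero    → ℕ.m≤m⊔n (f zero) K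
  (suc j) → ℕ.≤-trans (f≤K j) (ℕ.m≤n⊔m (f zero) K)

-- Halting probabilities

module _ {n} (G : Digraph n) (P : Program n) where

  0≤haltProb : ∀ b k h → 0ℚ ≤ℚ haltProb G P b k h
  0≤haltProb b k       h with P h
  0≤haltProb false k       h | halt false = 0≤1
  0≤haltProb false k       h | halt true  = ℚ.≤-refl
  0≤haltProb true  k       h | halt false = ℚ.≤-refl
  0≤haltProb true  k       h | halt true  = 0≤1
  0≤haltProb b     zero    h | flip       = ℚ.≤-refl
  0≤haltProb b     zero    h | pre _      = ℚ.≤-refl
  0≤haltProb b     zero    h | post _     = ℚ.≤-refl
  0≤haltProb b     (suc k) h | flip       =
    mean-mono-≤ {0ℚ} {r = 0ℚ} (0≤haltProb b k _) (0≤haltProb b k _)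
  0≤haltProb b     (suc k) h | pre _      = 0≤haltProb b k _
  0≤haltProb b     (suc k) h | post _     = 0≤haltProb b k _

  haltProb≤1 : ∀ b k h → haltProb G P b k h ≤ℚ 1ℚ
  haltProb≤1 b k       h with P h
  haltProb≤1 false k       h | halt false = ℚ.≤-refl
  haltProb≤1 false k       h | halt true  = 0≤1
  haltProb≤1 true  k       h | halt false = 0≤1
  haltProb≤1 true  k       h | halt true  = ℚ.≤-refl
  haltProb≤1 b     zero    h | flip       = 0≤1
  haltProb≤1 b     zero    h | pre _      = 0≤1
  haltProb≤1 b     zero    h | post _     = 0≤1
  haltProb≤1 b     (suc k) h | flip       = mean-≤ (haltProb≤1 b k _) (haltProb≤1 b k _)
  haltProb≤1 b     (suc k) h | pre _      = haltProb≤1 b k _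
  haltProb≤1 b     (suc k) h | post _     = haltProb≤1 b k _

  haltProb-mono-≤ : ∀ b {k l} h → k ≤ l → haltProb G P b k h ≤ℚ haltProb G P b l h
  -- Abstracting the nonnegativity fact together with `P h` lets its type unfold to the goal in the
  -- three non-halting cases.
  haltProb-mono-≤ b {zero} {l} h z≤n with P h | 0≤haltProb b l h
  ... | halt _ | _  = ℚ.≤-refl
  ... | flip   | 0≤ = 0≤
  ... | pre _  | 0≤ = 0≤
  ... | post _ | 0≤ = 0≤
  haltProb-mono-≤ b h (s≤s k≤l) with P h
  ... | halt _ = ℚ.≤-refl
  ... | flip   = mean-mono-≤ (haltProb-mono-≤ b _ k≤l) (haltProb-mono-≤ b _ k≤l)
  ... | pre _  = haltProb-mono-≤ b _ k≤l
  ... | post _ = haltProb-mono-≤ b _ k≤l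

  -- Without coin flips the run is forced, and each event in `h` costs one step: after `length h`
  -- steps the computation from `[]` stands at `h`.
  haltProb-run : (∀ h → P h ≢ flip) → ∀ b k {h} → Run G P h →
                 haltProb G P b (k ℕ.+ length h) [] ≡ haltProb G P b k h
  haltProb-run noFlip b k start rewrite ℕ.+-identityʳ k = refl
  haltProb-run noFlip b k (flipStep {h} r eq _) = contradiction eq (noFlip h)
  haltProb-run noFlip b k (preStep {h} r eq)
    rewrite ℕ.+-suc k (length h) | haltProb-run noFlip b (suc k) r | eq = refl
  haltProb-run noFlip b k (postStep {h} r eq)
    rewrite ℕ.+-suc k (length h) | haltProb-run noFlip b (suc k) r | eq = refl

  haltProb-halt : ∀ b k {h} → P h ≡ halt b → haltProb G P b k h ≡ 1ℚ
  haltProb-halt true  k eq rewrite eq = refl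
  haltProb-halt false k eq rewrite eq = refl

  deterministic⇒probabilistic : (∀ h → P h ≢ flip) → ∀ {p b} → p ≤ℚ 1ℚ →
    Outputs G P b → OutputsWithProbAtLeast G P p b
  deterministic⇒probabilistic noFlip {b = b} p≤1 (h , r , eq) q q<p =
    length h , ℚ.≤-trans (ℚ.≤-trans (ℚ.<⇒≤ q<p) p≤1) (ℚ.≤-reflexive (sym
      (trans (haltProb-run noFlip b 0 r) (haltProb-halt b 0 eq))))

-- The hybrid argument

module _ {n N} (G : Digraph n) (H : Fin N → Digraph n) where

  DistinguishesAtMostOne : (Digraph n → Subset n → Subset n) → Set
  DistinguishesAtMostOne op = ∀ S → ∃[ m ] ∀ j → toℕ j ≢ m → op (H j) S ≡ op G S

  module Hybrid (pre-one : DistinguishesAtMostOne Pre) (post-one : DistinguishesAtMostOne Post)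
                (P : Program n) where

    -- Both computations continue from the same history, each with the answers of its own graph.
    -- Subtracting 1 makes the value 0 wherever `P` halts.
    advantage : ℕ → History n → Fin N → ℚ
    advantage k h j = haltProb G P true k h +ℚ haltProb (H j) P false k h -ℚ 1ℚ

    -- The single distinguished H j changes a probability, hence the sum, by at most 1.
    advantage-answer : ∀ {op} → DistinguishesAtMostOne op → ∀ k h S →
      sum (λ j → haltProb G P true k (answer (op G S) ∷ h)
                   +ℚ haltProb (H j) P false k (answer (op (H j) S) ∷ h) -ℚ 1ℚ)
        ≤ℚ 1ℚ +ℚ sum (advantage k (answer (op G S) ∷ h))
    advantage-answer {op} one k h S with m , agree ← one S = sum-mono-≤-except m bound equal
      where
      h′ = answer (op G S) ∷ h
      p = haltProb G P true k h′
      -- At the distinguished `j` the graph `H j` gives another answer, so nothing relates `x` to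
      -- `y` beyond `x ≤ 1` and `0 ≤ y`.
      bound : ∀ j → p +ℚ haltProb (H j) P false k (answer (op (H j) S) ∷ h) -ℚ 1ℚ
                      ≤ℚ 1ℚ +ℚ advantage k h′ j
      bound j = begin
        p +ℚ x -ℚ 1ℚ           ≤⟨ ℚ.+-monoˡ-≤ (-ℚ 1ℚ) (ℚ.+-monoʳ-≤ p (haltProb≤1 (H j) P false k _)) ⟩
        p +ℚ 1ℚ -ℚ 1ℚ          ≡⟨ solve 1 (λ p → p :+ con 1ℚ :- con 1ℚ := p :+ con 0ℚ) refl p ⟩
        p +ℚ 0ℚ                ≤⟨ ℚ.+-monoʳ-≤ p (0≤haltProb (H j) P false k h′) ⟩
        p +ℚ y                 ≡⟨ solve 2 (λ p y → p :+ y := con 1ℚ :+ (p :+ y :- con 1ℚ)) refl p y ⟩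
        1ℚ +ℚ (p +ℚ y -ℚ 1ℚ)   ∎
        where
        open ℚ.≤-Reasoning
        x = haltProb (H j) P false k (answer (op (H j) S) ∷ h)
        y = haltProb (H j) P false k h′
      equal : ∀ j → toℕ j ≢ m →
        p +ℚ haltProb (H j) P false k (answer (op (H j) S) ∷ h) -ℚ 1ℚ ≤ℚ advantage k h′ j
      equal j j≢m = ℚ.≤-reflexive
        (cong (λ A → p +ℚ haltProb (H j) P false k (answer A ∷ h) -ℚ 1ℚ) (agree j j≢m))

    -- The bit does not depend on the graph, so both probabilities average over the same two
    -- histories, and the subtracted 1 is the mean of two 1s.
    advantage-flip : ∀ k h →
      sum (λ j → ½ *ℚ (haltProb G P true k (bit false ∷ h) +ℚ haltProb G P true k (bit true ∷ h))
                   +ℚ ½ *ℚ (haltProb (H j) P false k (bit false ∷ h)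
                              +ℚ haltProb (H j) P false k (bit true ∷ h)) -ℚ 1ℚ)
        ≡ ½ *ℚ (sum (advantage k (bit false ∷ h)) +ℚ sum (advantage k (bit true ∷ h)))
    advantage-flip k h = trans
      (sum-cong-≗ λ j → solve 4 (λ a b c d →
          con ½ :* (a :+ b) :+ con ½ :* (c :+ d) :- con 1ℚ
            := con ½ :* ((a :+ c :- con 1ℚ) :+ (b :+ d :- con 1ℚ)))
        refl
        (haltProb G P true k (bit false ∷ h)) (haltProb G P true k (bit true ∷ h))
        (haltProb (H j) P false k (bit false ∷ h)) (haltProb (H j) P false k (bit true ∷ h)))
      (sum-mean (advantage k (bit false ∷ h)) (advantage k (bit true ∷ h)))

    ReachesOperations : ℚ → Set
    ReachesOperations x = ∃[ h ] Run G P h × x ≤ℚ + operations h / 1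

    stop : ∀ {h} → Run G P h → ∀ {f : Fin N → ℚ} → (∀ j → f j ≤ℚ 0ℚ) →
           ReachesOperations (sum f +ℚ + operations h / 1)
    stop {h} r {f} f≤0 = h , r , (begin
      sum f +ℚ o          ≤⟨ ℚ.+-monoˡ-≤ o (sum-mono-≤ f≤0) ⟩
      sum z +ℚ o          ≡⟨ cong (_+ℚ o) (trans (sum-const N 0ℚ) (ℚ.*-zeroˡ (+ N / 1))) ⟩
      0ℚ +ℚ o             ≡⟨ ℚ.+-identityˡ o ⟩
      o                   ∎)
      where
      open ℚ.≤-Reasoning
      o = + operations h / 1
      z : Fin N → ℚ
      z _ = 0ℚ

    weaken : ∀ {x y} → x ≤ℚ y → ReachesOperations y → ReachesOperations x
    weaken x≤y (h , r , y≤) = h , r , ℚ.≤-trans x≤y y≤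

    -- The 1 that the sum of advantages may lose is regained in the operation count, so their total
    -- does not fall.
    charge : ∀ {x} y m → x ≤ℚ 1ℚ +ℚ y → x +ℚ + m / 1 ≤ℚ y +ℚ + suc m / 1
    charge {x} y m x≤1+y = begin
      x +ℚ + m / 1            ≤⟨ ℚ.+-monoˡ-≤ (+ m / 1) x≤1+y ⟩
      1ℚ +ℚ y +ℚ + m / 1      ≡⟨ solve 2 (λ y o → con 1ℚ :+ y :+ o := y :+ (con 1ℚ :+ o)) refl y (+ m / 1) ⟩
      y +ℚ (1ℚ +ℚ + m / 1)    ≡⟨ cong (y +ℚ_) (suc/1 m) ⟨
      y +ℚ + suc m / 1        ∎
      where
      open ℚ.≤-Reasoning

    -1≤0 : 0ℚ +ℚ 0ℚ -ℚ 1ℚ ≤ℚ 0ℚ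
    -1≤0 = toWitness {a? = _ ℚ.≤? _} _

    -- At a coin flip, follow the outcome with the larger total advantage.
    hybrid : ∀ k {h} → Run G P h →
             ReachesOperations (sum (advantage k h) +ℚ + operations h / 1)
    hybrid k {h} r with P h in eq
    -- At a halt exactly one of the two probabilities is 1, so every summand is 0.
    hybrid k       r | halt true  = stop r λ _ → ℚ.≤-refl
    hybrid k       r | halt false = stop r λ _ → ℚ.≤-refl
    -- With the step bound exhausted both probabilities are 0, so every summand is -1.
    hybrid zero    r | flip       = stop r λ _ → -1≤0
    hybrid zero    r | pre _      = stop r λ _ → -1≤0
    hybrid zero    r | post _     = stop r λ _ → -1≤0
    hybrid (suc k) {h} r | flip   =
      [ (λ x₀≤x₁ → follow true (mean-≤ x₀≤x₁ ℚ.≤-refl))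
      , (λ x₁≤x₀ → follow false (mean-≤ ℚ.≤-refl x₁≤x₀))
      ]′ (ℚ.≤-total (x false) (x true))
      where
      x : Bool → ℚ
      x b = sum (advantage k (bit b ∷ h))
      follow : ∀ b → ½ *ℚ (x false +ℚ x true) ≤ℚ x b → _
      follow b mean≤x = weaken
        (ℚ.+-monoˡ-≤ (+ operations h / 1)
          (subst (_≤ℚ x b) (sym (advantage-flip k h)) mean≤x))
        (hybrid k (flipStep r eq b))
    hybrid (suc k) {h} r | pre S  =
      weaken (charge (sum (advantage k (answer (Pre G S) ∷ h))) (operations h)
                     (advantage-answer pre-one k h S))
             (hybrid k (preStep r eq))
    hybrid (suc k) {h} r | post S =
      weaken (charge (sum (advantage k (answer (Post G S) ∷ h))) (operations h)
                     (advantage-answer post-one k h S))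
             (hybrid k (postStep r eq))

-- The graphs G and H j

-- Forward steps of length 1 force distance `D` from 0 to `D`. The backward edges and loops offer
-- each vertex many alternative edges, which hide a single removed one.
full : ∀ D → Digraph (suc D)
full D = record
  { Edge  = λ u v → toℕ v ≤ suc (toℕ u)
  ; edge? = λ u v → toℕ v ℕ.≤? suc (toℕ u)
  }

cut : ∀ {D} → Fin D → Digraph (suc D)
cut {D} j = record
  { Edge  = λ u v → toℕ v ≤ suc (toℕ u) × ¬ (toℕ u ≡ toℕ j × toℕ v ≡ suc (toℕ j))
  ; edge? = λ u v → toℕ v ℕ.≤? suc (toℕ u)
              ×-dec ¬? (toℕ u ℕ.≟ toℕ j ×-dec toℕ v ℕ.≟ suc (toℕ j))
  }

full-reachable : ∀ D → Reachability (full D) zero ⁅ fromℕ D ⁆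
full-reachable D = p , refl , edge , D , subst (_∈ ⁅ fromℕ D ⁆) (sym pD≡D) (x∈⁅x⁆ (fromℕ D))
  where
  p : ℕ → Fin (suc D)
  -- Reachability asks for an infinite path: after climbing to `D`, it stays there on the loop.
  p i = Fin.fromℕ< (s≤s (ℕ.m⊓n≤n i D))
  toℕ-p : ∀ i → toℕ (p i) ≡ i ⊓ D
  toℕ-p i = Fin.toℕ-fromℕ< (s≤s (ℕ.m⊓n≤n i D))
  edge : ∀ i → toℕ (p (suc i)) ≤ suc (toℕ (p i))
  edge i = subst₂ (λ x y → x ≤ suc y) (sym (toℕ-p (suc i))) (sym (toℕ-p i))
                  (ℕ.⊓-monoʳ-≤ (suc i) (ℕ.n≤1+n D))
  pD≡D : p D ≡ fromℕ D
  pD≡D = Fin.toℕ-injective (trans (toℕ-p D) (trans (ℕ.⊓-idem D) (sym (Fin.toℕ-fromℕ D))))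

-- The only edge of `full D` leaving the vertices up to `j` is the removed one, so a path from 0
-- stays at or below `j < D`.
cut-unreachable : ∀ {D} (j : Fin D) → ¬ Reachability (cut j) zero ⁅ fromℕ D ⁆
cut-unreachable {D} j (p , p0≡0 , edge , i , pi∈T) = ℕ.<⇒≱ (Fin.toℕ<n j) (begin
  D              ≡⟨ Fin.toℕ-fromℕ D ⟨
  toℕ (fromℕ D)  ≡⟨ cong toℕ (x∈⁅y⁆⇒x≡y (fromℕ D) pi∈T) ⟨
  toℕ (p i)      ≤⟨ before i ⟩
  toℕ j          ∎)
  where
  open ℕ.≤-Reasoning
  before : ∀ i → toℕ (p i) ≤ toℕ j
  before zero = subst (λ u → toℕ u ≤ toℕ j) (sym p0≡0) z≤n
  before (suc i) with step , uncut ← edge i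
    with ℕ.m≤n⇒m<n∨m≡n (ℕ.≤-trans step (s≤s (before i)))
  ... | inj₁ (s≤s next≤j) = next≤j
  ... | inj₂ next≡1+j     = contradiction
    (ℕ.≤-antisym (before i) (ℕ.s≤s⁻¹ (subst (_≤ suc (toℕ (p i))) next≡1+j step)) , next≡1+j) uncut

climb : ∀ {D} d {u v : Fin (suc D)} → toℕ v ≡ d ℕ.+ toℕ u → Path (full D) d u v
climb zero v≡u with refl ← Fin.toℕ-injective v≡u = []
climb {D} (suc d) {u} {v} v≡1+d+u =
  ℕ.≤-reflexive toℕ-w ∷ climb d (begin
    toℕ v              ≡⟨ v≡1+d+u ⟩
    suc (d ℕ.+ toℕ u)  ≡⟨ ℕ.+-suc d (toℕ u) ⟨
    d ℕ.+ suc (toℕ u)  ≡⟨ cong (d ℕ.+_) toℕ-w ⟨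
    d ℕ.+ toℕ w        ∎)
  where
  open ≡-Reasoning
  1+u<1+D : suc (toℕ u) ℕ.< suc D
  1+u<1+D = ℕ.≤-<-trans (subst (suc (toℕ u) ≤_) (sym v≡1+d+u) (s≤s (ℕ.m≤n+m (toℕ u) d)))
                        (Fin.toℕ<n v)
  w = Fin.fromℕ< 1+u<1+D
  toℕ-w : toℕ w ≡ suc (toℕ u)
  toℕ-w = Fin.toℕ-fromℕ< 1+u<1+D

-- Each edge rises by at most 1; hence a path from 0 to `D` has at least `D` edges.
path-rise : ∀ {D l} {u v : Fin (suc D)} → Path (full D) l u v → toℕ v ≤ l ℕ.+ toℕ u
path-rise []                                = ℕ.≤-refl
path-rise {l = suc l} {u} (_∷_ {v = w} e π) = ℕ.≤-trans (path-rise π)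
  (subst (l ℕ.+ toℕ w ≤_) (ℕ.+-suc l (toℕ u)) (ℕ.+-monoʳ-≤ l e))

full-diameter : ∀ D → IsDiameter (full D) D
full-diameter D = (zero , fromℕ D , climb D toℕ-D , λ l π → begin
    D              ≡⟨ Fin.toℕ-fromℕ D ⟨
    toℕ (fromℕ D)  ≤⟨ path-rise π ⟩
    l ℕ.+ 0        ≡⟨ ℕ.+-identityʳ l ⟩
    l              ∎)
  , bound
  where
  open ℕ.≤-Reasoning
  toℕ-D : toℕ (fromℕ D) ≡ D ℕ.+ 0
  toℕ-D = trans (Fin.toℕ-fromℕ D) (sym (ℕ.+-identityʳ D))
  bound : ∀ u v d → IsDistance (full D) u v d → d ≤ D
  bound u v d (_ , shortest) with ℕ.≤-<-connex (toℕ u) (toℕ v)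
  ... | inj₁ u≤v = ℕ.≤-trans (shortest _ (climb (toℕ v ℕ.∸ toℕ u) (sym (ℕ.m∸n+n≡m u≤v))))
                             (ℕ.≤-trans (ℕ.m∸n≤m (toℕ v) (toℕ u)) (Fin.toℕ≤pred[n] v))
  -- A single backward edge suffices here, and `1 ≤ D` because `u` lies above `v`.
  ... | inj₂ v<u = ℕ.≤-trans (shortest 1 (ℕ.m≤n⇒m≤1+n (ℕ.<⇒≤ v<u) ∷ []))
                             (ℕ.≤-trans (ℕ.≤-trans (s≤s z≤n) v<u) (Fin.toℕ≤pred[n] u))

-- Which removed edges an operation can detect

module _ {n} (G G′ : Digraph n) (S : Subset n) where
  private
    module G  = Digraph G
    module G′ = Digraph G′

  Pre-cong : (∀ v → (∃[ w ] w ∈ S × G.Edge v w) ⇔ (∃[ w ] w ∈ S × G′.Edge v w)) →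
             Pre G S ≡ Pre G′ S
  Pre-cong eq = tabulate-cong λ v → does-⇔ (eq v)
    (Fin.any? λ w → (w ∈? S) ×-dec G.edge? v w) (Fin.any? λ w → (w ∈? S) ×-dec G′.edge? v w)

  Post-cong : (∀ v → (∃[ w ] w ∈ S × G.Edge w v) ⇔ (∃[ w ] w ∈ S × G′.Edge w v)) →
              Post G S ≡ Post G′ S
  Post-cong eq = tabulate-cong λ v → does-⇔ (eq v)
    (Fin.any? λ w → (w ∈? S) ×-dec G.edge? w v) (Fin.any? λ w → (w ∈? S) ×-dec G′.edge? w v)

unique⇒index : ∀ {N} {C : Fin N → Set} → (∀ j → Dec (C j)) →
  (∀ {i j} → C i → C j → i ≡ j) → ∃[ m ] ∀ j → toℕ j ≢ m → ¬ C j
unique⇒index C? unique with Fin.any? C?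
... | yes (i , ci) = toℕ i , λ j j≢i cj → j≢i (cong toℕ (unique cj ci))
-- If no index satisfies `C`, any number serves as `m`.
... | no ¬∃c       = 0 , λ j _ cj → ¬∃c (j , cj)

module _ {D} (S : Subset (suc D)) where

  -- Indexed by cuts: `inject₁ j` is the tail of the removed edge.
  IsGreatest : Fin D → Set
  IsGreatest j = inject₁ j ∈ S × ¬ (∃[ w ] w ∈ S × toℕ j ℕ.< toℕ w)

  isGreatest? : ∀ j → Dec (IsGreatest j)
  isGreatest? j = (inject₁ j ∈? S) ×-dec ¬? (Fin.any? λ w → (w ∈? S) ×-dec (toℕ j ℕ.<? toℕ w))

  greatest-unique : ∀ {i j} → IsGreatest i → IsGreatest j → i ≡ j
  greatest-unique {i} {j} (i∈S , i-max) (j∈S , j-max) with ℕ.<-cmp (toℕ i) (toℕ j)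
  ... | tri< i<j _ _ = contradiction
    (inject₁ j , j∈S , subst (toℕ i ℕ.<_) (sym (Fin.toℕ-inject₁ j)) i<j) i-max
  ... | tri≈ _ i≡j _ = Fin.toℕ-injective i≡j
  ... | tri> _ _ j<i = contradiction
    (inject₁ i , i∈S , subst (toℕ j ℕ.<_) (sym (Fin.toℕ-inject₁ i)) j<i) j-max

  -- Here `suc j` is the head of the removed edge, and the vertices below it are those up to `j`.
  IsLeast : Fin D → Set
  IsLeast j = suc j ∈ S × ¬ (∃[ w ] w ∈ S × toℕ w ≤ toℕ j)

  isLeast? : ∀ j → Dec (IsLeast j)
  isLeast? j = (suc j ∈? S) ×-dec ¬? (Fin.any? λ w → (w ∈? S) ×-dec (toℕ w ℕ.≤? toℕ j))

  least-unique : ∀ {i j} → IsLeast i → IsLeast j → i ≡ j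
  least-unique {i} {j} (i∈S , i-min) (j∈S , j-min) with ℕ.<-cmp (toℕ i) (toℕ j)
  ... | tri< i<j _ _ = contradiction (suc i , i∈S , i<j) j-min
  ... | tri≈ _ i≡j _ = Fin.toℕ-injective i≡j
  ... | tri> _ _ j<i = contradiction (suc j , j∈S , j<i) i-min

  -- Only `j + 1` could drop out of the answer, and only when reached from `j`. An element `x > j`
  -- of `S` still has its edge to `j + 1`, a loop or a backward edge.
  Post-cut : ∀ j → ¬ IsGreatest j → Post (cut j) S ≡ Post (full D) S
  Post-cut j ¬greatest = Post-cong (cut j) (full D) S λ v → mk⇔
    (λ (w , w∈S , edge , _) → w , w∈S , edge)
    (λ (w , w∈S , edge) → avoid v w w∈S edge)
    where
    avoid : ∀ v w → w ∈ S → toℕ v ≤ suc (toℕ w) → ∃[ w ] w ∈ S × Digraph.Edge (cut j) w v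
    avoid v w w∈S edge with toℕ w ℕ.≟ toℕ j | toℕ v ℕ.≟ suc (toℕ j)
    ... | no w≢j  | _          = w , w∈S , edge , w≢j ∘ proj₁
    ... | yes _   | no v≢1+j   = w , w∈S , edge , v≢1+j ∘ proj₂
    ... | yes w≡j | yes v≡1+j
      with refl ← Fin.toℕ-injective {i = w} {j = inject₁ j} (trans w≡j (sym (Fin.toℕ-inject₁ j)))
      with Fin.any? (λ x → (x ∈? S) ×-dec (toℕ j ℕ.<? toℕ x))
    ...   | yes (x , x∈S , j<x) =
            x , x∈S , subst (_≤ suc (toℕ x)) (sym v≡1+j) (ℕ.m≤n⇒m≤1+n j<x)
              , λ (x≡j , _) → ℕ.<⇒≢ j<x (sym x≡j)
    ...   | no none = contradiction (w∈S , none) ¬greatest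

  -- Dually, only `j` could drop out, and any element `x ≤ j` of `S` is still reached from `j` by a
  -- loop or a backward edge.
  Pre-cut : ∀ j → ¬ IsLeast j → Pre (cut j) S ≡ Pre (full D) S
  Pre-cut j ¬least = Pre-cong (cut j) (full D) S λ v → mk⇔
    (λ (w , w∈S , edge , _) → w , w∈S , edge)
    (λ (w , w∈S , edge) → avoid v w w∈S edge)
    where
    avoid : ∀ v w → w ∈ S → toℕ w ≤ suc (toℕ v) → ∃[ w ] w ∈ S × Digraph.Edge (cut j) v w
    avoid v w w∈S edge with toℕ v ℕ.≟ toℕ j | toℕ w ℕ.≟ suc (toℕ j)
    ... | no v≢j  | _          = w , w∈S , edge , v≢j ∘ proj₁
    ... | yes _   | no w≢1+j   = w , w∈S , edge , w≢1+j ∘ proj₂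
    ... | yes v≡j | yes w≡1+j
      with refl ← Fin.toℕ-injective {i = w} {j = suc j} w≡1+j
      with Fin.any? (λ x → (x ∈? S) ×-dec (toℕ x ℕ.≤? toℕ j))
    ...   | yes (x , x∈S , x≤j) =
            x , x∈S , subst (λ y → toℕ x ≤ suc y) (sym v≡j) (ℕ.m≤n⇒m≤1+n x≤j)
              , λ (_ , x≡1+j) → ℕ.<⇒≢ (s≤s x≤j) x≡1+j
    ...   | no none = contradiction (w∈S , none) ¬least

pre-distinguishes : ∀ D → DistinguishesAtMostOne (full D) cut Pre
pre-distinguishes D S with m , ¬least ← unique⇒index (isLeast? S) (least-unique S) =
  m , λ j j≢m → Pre-cut S j (¬least j j≢m)

post-distinguishes : ∀ D → DistinguishesAtMostOne (full D) cut Post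
post-distinguishes D S with m , ¬greatest ← unique⇒index (isGreatest? S) (greatest-unique S) =
  m , λ j j≢m → Post-cut S j (¬greatest j j≢m)

-- The lower bound

deterministic-solves : ∀ A → Deterministic A → SolvesReachability A →
                       SolvesReachabilityWithBoundedError A
deterministic-solves A noFlip solves n G s T =
    convert ∘ proj₁ (solves n G s T)
  , convert ∘ proj₂ (solves n G s T)
  where
  convert : ∀ {b} → Outputs G (A n s T) b → OutputsWithProbAtLeast G (A n s T) (+ 2 / 3) b
  convert = deterministic⇒probabilistic G (A n s T) (noFlip n s T)
              (toWitness {a? = + 2 / 3 ℚ.≤? 1ℚ} _)

boundedError⇒operations : ∀ A → SolvesReachabilityWithBoundedError A → ∀ D →
  ∃[ h ] Run (full D) (A (suc D) zero ⁅ fromℕ D ⁆) h ×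
         (+ 1 / 5) *ℚ (+ D / 1) ≤ℚ + operations h / 1
boundedError⇒operations A solves D = weaken bound (hybrid K start)
  where
  P = A (suc D) zero ⁅ fromℕ D ⁆
  open Hybrid (full D) cut (pre-distinguishes D) (post-distinguishes D) P

  3/5<2/3 : + 3 / 5 <ℚ + 2 / 3
  3/5<2/3 = toWitness {a? = _ ℚ.<? _} _

  -- The bound 2/3 concerns a supremum over step bounds that need not be attained; the smaller 3/5
  -- is attained at a finite one.
  accepts : ∃[ k ] + 3 / 5 ≤ℚ haltProb (full D) P true k []
  accepts = proj₁ (solves _ (full D) zero ⁅ fromℕ D ⁆) (full-reachable D) _ 3/5<2/3

  rejects : ∀ j → ∃[ k ] + 3 / 5 ≤ℚ haltProb (cut j) P false k []
  rejects j = proj₂ (solves _ (cut j) zero ⁅ fromℕ D ⁆) (cut-unreachable j) _ 3/5<2/3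

  -- As there are finitely many cuts, one step bound `K` serves `full D` and all of them at once.
  L = upper-bound (proj₁ ∘ rejects)
  K = proj₁ accepts ⊔ proj₁ L

  advantage≥1/5 : ∀ j → + 1 / 5 ≤ℚ advantage K [] j
  advantage≥1/5 j = ℚ.+-monoˡ-≤ (-ℚ 1ℚ) (ℚ.+-mono-≤ {+ 3 / 5} {u = + 3 / 5}
    (ℚ.≤-trans (proj₂ accepts)
      (haltProb-mono-≤ (full D) P true [] (ℕ.m≤m⊔n (proj₁ accepts) (proj₁ L))))
    (ℚ.≤-trans (proj₂ (rejects j))
      (haltProb-mono-≤ (cut j) P false []
        (ℕ.≤-trans (proj₂ L j) (ℕ.m≤n⊔m (proj₁ accepts) (proj₁ L))))))

  -- The trailing `0ℚ` is the operation count of the empty history, where `hybrid` starts.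
  bound : (+ 1 / 5) *ℚ (+ D / 1) ≤ℚ sum (advantage K []) +ℚ 0ℚ
  bound = begin
    (+ 1 / 5) *ℚ (+ D / 1)        ≡⟨ sum-const D (+ 1 / 5) ⟨
    sum {D} (λ _ → + 1 / 5)       ≤⟨ sum-mono-≤ advantage≥1/5 ⟩
    sum (advantage K [])          ≡⟨ ℚ.+-identityʳ _ ⟨
    sum (advantage K []) +ℚ 0ℚ    ∎
    where open ℚ.≤-Reasoning

theorem3p8 : ∃[ c ] 0ℚ <ℚ c ×
    ((A : Algorithm) →
    (Deterministic A × SolvesReachability A) ⊎ SolvesReachabilityWithBoundedError A →
    ∀ (D₀ : ℕ) →
    ∃[ n ] ∃[ G ] ∃[ s ] ∃[ T ] ∃[ D ]
    D₀ ≤ D × IsDiameter {n} G D ×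
    (∃[ h ] Run G (A n s T) h × c *ℚ (+ D / 1) ≤ℚ (+ operations h / 1)))
-- The constant is the least advantage per cut, and the diameter is `D₀` itself.
theorem3p8 = + 1 / 5 , toWitness {a? = 0ℚ ℚ.<? + 1 / 5} _ , λ A solves D →
  suc D , full D , zero , ⁅ fromℕ D ⁆ , D , ℕ.≤-refl , full-diameter D ,
  boundedError⇒operations A
    ([ (λ (noFlip , exact) → deterministic-solves A noFlip exact) , id ]′ solves) D
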